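{- Let $m,n$ be integers with either $m\ge 3$ and $n\ge 2$, or $m=2$ and $n\ge 3$. Then there exists a finite relational structure $\mathbb{A}$ whose universe has exactly $n$ elements and all of whose relations have arity at most $m$ such that $\mathbb{A}$ admits a near-unanimity polymorphism, but $\mathbb{A}$ admits no near-unanimity polymorphism of arity less than or equal to $(m-1)^{2^{n-2}}$ if $m\ge3$, respectively $2^{2^{n-3}}$ if $m=2$.
   Context: An operation $t:A^k\to A$ with $k\ge 3$ is a near-unanimity (NU) operation if $t(b,a,\dots,a)=t(a,b,a,\dots,a)=\dots=t(a,\dots,a,b)=b$ for all $a,b\in A$. A polymorphism of a relational structure is an operation on its universe that is compatible with every relation of the structure. Compatibility of $t:A^k\to A$ with an $r$-ary relation $R$ means: whenever $k$ tuples (the columns) lie in $R$, the tuple obtained by applying $t$ to them coordinatewise also lies in $R$.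
   Formalization: The near-unanimity identities are taken in the standard form t(b,a,…,a)=…=t(a,…,a,b)=a; the form "= b" given in the context is a misprint, under which the claim fails for m=4, n=2, since x+y+z would always be a polymorphism of arity 3. -}

module Defs where

open import Data.Fin using (Fin)
open import Data.Nat using (ℕ; _≤_)
open import Data.Product using (∃; _×_)
open import Data.Vec using (Vec; map; transpose; replicate; _[_]≔_)
open import Data.Vec.Relation.Unary.All using (All)
open import Level using (0ℓ)
open import Relation.Binary.PropositionalEquality using (_≡_)
open import Relation.Unary using (Pred)

-- Finiteness of the universe is not built in; it is imposed where needed by a
-- bijection with Fin n.
record RelationalStructure : Set₁ where
  field
    Universe   : Set
    #relations : ℕ
    arity      : Fin #relations → ℕ
    relation   : (i : Fin #relations) → Pred (Vec Universe (arity i)) 0ℓ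

-- Arguments are vectors rather than functions Fin k → A, because without
-- function extensionality an operation on functions need not respect
-- pointwise equality of its arguments.
Operation : Set → ℕ → Set
Operation A k = Vec A k → A

-- The vector of tuples lists the k columns; `transpose` turns them into the
-- r rows to which t is applied.
Compatible : ∀ {A k r} → Operation A k → Pred (Vec A r) 0ℓ → Set
Compatible {A} {k} {r} t R =
  (columns : Vec (Vec A r) k) → All R columns → R (map t (transpose columns))

IsPolymorphism : (𝔸 : RelationalStructure) → let open RelationalStructure 𝔸 in
                 ∀ {k} → Operation Universe k → Set
IsPolymorphism 𝔸 t = ∀ i → Compatible t (relation i)
  where open RelationalStructure 𝔸

-- The entry at position i deviates (it is b); the value is the repeated element a.
IsNearUnanimity : ∀ {A k} → Operation A k → Set
IsNearUnanimity {A} {k} t =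
  3 ≤ k × (∀ (i : Fin k) (a b : A) → t (replicate k a [ i ]≔ b) ≡ a)

HasNUPolymorphism : RelationalStructure → ℕ → Set
HasNUPolymorphism 𝔸 k =
  ∃ λ (t : Operation Universe k) → IsNearUnanimity t × IsPolymorphism 𝔸 t
  where open RelationalStructure 𝔸

{-# OPTIONS --safe #-}
module Submission where

-- The universe consists of one or two "stars" below the "bits" 0, …, d, and its
-- subsets are read as binary numbers.  Let j be the least element of a set p of
-- bits.  If x₁, x₂, … all lie in p then the relations Descent e j, taken for all
-- stars e with children x₁, x₂, … of their own, force x₀ into p − 1.  From the set
-- containing only the top bit, 2 ^ d such steps lead to the empty set.  Each step
-- multiplies the number of arguments that may be stars instead by the total number
-- of children; once all arguments may be stars, the operation has no value left.
--
-- Conversely call v tight for p if few entries of v lie outside p, where "few"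
-- shrinks geometrically as the number p grows.  Then there is a least set for which
-- v is tight, and mapping v to the least element of that set is a near-unanimity
-- operation.  It preserves Descent e j since descending from j strictly decreases
-- the number, which pays for adding up the deviations of the children.

open import Defs
open import Data.Fin using (Fin)
open import Data.Nat using (ℕ; _≤_; _∸_; _^_)
open import Data.Product using (∃; _×_)
open import Data.Sum using (_⊎_)
open import Function.Bundles using (_↔_)
open import Relation.Binary.PropositionalEquality using (_≡_)
open import Relation.Nullary using (¬_)

open import Data.Fin using
  (zero; suc; toℕ; fromℕ; fromℕ<; inject≤; combine; remQuot; splitAt; _↑ˡ_; _↑ʳ_; _≟_; _<?_)
  renaming (_≤_ to _≤ᶠ_; _<_ to _<ᶠ_)
open import Data.Fin.Properties as Fin using
  (any?; all?; ¬∀⟶∃¬; toℕ-↑ˡ; toℕ-↑ʳ; join-splitAt; combine-remQuot; remQuot-combine; inject≤-injective)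
open import Data.Fin.Subset using
  (Subset; inside; outside; _∈_; _∉_; _⊆_; _∩_; _─_; ⊥; ⊤; ⁅_⁆; ∣_∣; Nonempty)
open import Data.Fin.Subset.Properties
open import Data.Nat as ℕ using (zero; suc; _+_; _*_; _<_; z≤n; s≤s)
open import Data.Nat.Induction using (<-wellFounded)
import Data.Nat.Properties as ℕ
open import Data.Product using (_,_; proj₁; proj₂; uncurry)
open import Data.Product.Properties using (≡-dec; ×-≡,≡→≡)
open import Data.Sum using (inj₁; inj₂)
open import Data.Sum.Properties using (inj₂-injective)
open import Data.Vec using
  (Vec; []; _∷_; lookup; map; tabulate; _⊛_; transpose; replicate; here; there; _[_]≔_)
open import Data.Vec.Properties hiding (≡-dec)
import Data.Vec.Relation.Unary.All.Properties as All
open import Function using (_∘_; case_of_)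
open import Function.Construct.Identity using (↔-id)
open import Induction.WellFounded using (Acc; acc)
open import Level using (0ℓ)
open import Relation.Binary.PropositionalEquality
open import Relation.Nullary using (Dec; yes; no; does; contradiction; ¬?)
open import Relation.Nullary.Decidable using (_×-dec_; _⊎-dec_; decidable-stable; dec-true; map′)
open import Relation.Unary using (Pred; Decidable)

private
  variable
    k n r : ℕ
    A : Set

-- Transposes, and counting in finite subsets.

lookup-transpose : ∀ {m} (xss : Vec (Vec A n) m) i →
                   lookup (transpose xss) i ≡ map (λ xs → lookup xs i) xss
lookup-transpose []         i = lookup-replicate i []
lookup-transpose {n = n} (xs ∷ xss) i = begin
  lookup (transpose (xs ∷ xss)) i
    ≡⟨ lookup-⊛ i (replicate n _∷_ ⊛ xs) (transpose xss) ⟩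
  lookup (replicate n _∷_ ⊛ xs) i (lookup (transpose xss) i)
    ≡⟨ cong (λ f → f (lookup (transpose xss) i)) (lookup-⊛ i (replicate n _∷_) xs) ⟩
  lookup (replicate n _∷_) i (lookup xs i) (lookup (transpose xss) i)
    ≡⟨ cong₂ (λ f ys → f (lookup xs i) ys) (lookup-replicate i _∷_) (lookup-transpose xss i) ⟩
  map (λ ys → lookup ys i) (xs ∷ xss) ∎
  where open ≡-Reasoning

subset : {P : Pred (Fin n) 0ℓ} → Decidable P → Subset n
subset P? = tabulate (does ∘ P?)

module _ {P : Pred (Fin n) 0ℓ} (P? : Decidable P) where

  ∈-subset⁺ : ∀ {x} → P x → x ∈ subset P?
  ∈-subset⁺ {x} px = lookup⇒[]= x _ (trans (lookup∘tabulate (does ∘ P?) x) (dec-true (P? x) px))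

  ∈-subset⁻ : ∀ {x} → x ∈ subset P? → P x
  ∈-subset⁻ {x} x∈p with P? x | trans (sym (lookup∘tabulate (does ∘ P?) x)) ([]=⇒lookup x∈p)
  ... | yes px | _ = px

∣p∣≤∣p─q∣+∣q∣ : ∀ (p q : Subset n) → ∣ p ∣ ≤ ∣ p ─ q ∣ + ∣ q ∣
∣p∣≤∣p─q∣+∣q∣ []           []           = z≤n
∣p∣≤∣p─q∣+∣q∣ (inside  ∷ p) (outside ∷ q) = s≤s (∣p∣≤∣p─q∣+∣q∣ p q)
∣p∣≤∣p─q∣+∣q∣ (outside ∷ p) (outside ∷ q) = ∣p∣≤∣p─q∣+∣q∣ p q
∣p∣≤∣p─q∣+∣q∣ (outside ∷ p) (inside  ∷ q) =
  ℕ.≤-trans (∣p∣≤∣p─q∣+∣q∣ p q) (ℕ.+-monoʳ-≤ ∣ p ─ q ∣ (ℕ.n≤1+n ∣ q ∣))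
∣p∣≤∣p─q∣+∣q∣ (inside  ∷ p) (inside  ∷ q) =
  ℕ.≤-trans (s≤s (∣p∣≤∣p─q∣+∣q∣ p q)) (ℕ.≤-reflexive (sym (ℕ.+-suc ∣ p ─ q ∣ ∣ q ∣)))

union-bound : ∀ (p : Subset n) (qs : Fin r → Subset n) {W} →
              (∀ {x} → x ∈ p → ∃ λ i → x ∈ qs i) → (∀ i → ∣ qs i ∣ ≤ W) →
              ∣ p ∣ ≤ r * W
union-bound {n} {zero} p qs cover small =
  ℕ.≤-trans (p⊆q⇒∣p∣≤∣q∣ {q = ⊥} λ x∈p → case cover x∈p of λ ()) (ℕ.≤-reflexive (∣⊥∣≡0 n))
union-bound {r = suc r} p qs {W} cover small = begin
  ∣ p ∣                           ≤⟨ ∣p∣≤∣p─q∣+∣q∣ p (qs zero) ⟩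
  ∣ p ─ qs zero ∣ + ∣ qs zero ∣   ≤⟨ ℕ.+-mono-≤ (union-bound (p ─ qs zero) (qs ∘ suc) cover′ (small ∘ suc)) (small zero) ⟩
  r * W + W                       ≡⟨ ℕ.+-comm (r * W) W ⟩
  W + r * W                       ∎
  where
  open ℕ.≤-Reasoning
  cover′ : ∀ {x} → x ∈ p ─ qs zero → ∃ λ i → x ∈ qs (suc i)
  cover′ x∈ with cover (p─q⊆p p (qs zero) x∈)
  ... | suc i , x∈q = i , x∈q
  ... | zero  , x∈q = contradiction x∈q (p─q-disjoint p (qs zero) x∈)
    where
    p─q-disjoint : ∀ {n} (p q : Subset n) {x} → x ∈ p ─ q → x ∉ q
    p─q-disjoint (_ ∷ p) (inside ∷ q) (there x∈) (there x∈q) = p─q-disjoint p q x∈ x∈q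
    p─q-disjoint (_ ∷ p) (outside ∷ q) (there x∈) (there x∈q) = p─q-disjoint p q x∈ x∈q

-- Subsets as binary numbers, with the least element as lowest digit.

value : Subset n → ℕ
value []            = 0
value (inside  ∷ p) = suc (2 * value p)
value (outside ∷ p) = 2 * value p

value<2^n : ∀ (p : Subset n) → value p < 2 ^ n
value<2^n []            = s≤s z≤n
value<2^n {suc n} (inside  ∷ p) = begin
  2 + 2 * value p     ≡⟨ ℕ.*-suc 2 (value p) ⟨
  2 * suc (value p)   ≤⟨ ℕ.*-monoʳ-≤ 2 (value<2^n p) ⟩
  2 * 2 ^ n           ∎
  where open ℕ.≤-Reasoning
value<2^n (outside ∷ p) = ℕ.*-monoʳ-< 2 (value<2^n p)

value-mono : ∀ {p q : Subset n} → p ⊆ q → value p ≤ value q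
value-mono {p = []}          {[]}          _   = z≤n
value-mono {p = inside  ∷ p} {inside  ∷ q} p⊆q = s≤s (ℕ.*-monoʳ-≤ 2 (value-mono (drop-∷-⊆ p⊆q)))
value-mono {p = inside  ∷ p} {outside ∷ q} p⊆q = case p⊆q here of λ ()
value-mono {p = outside ∷ p} {inside  ∷ q} p⊆q = ℕ.m≤n⇒m≤1+n (ℕ.*-monoʳ-≤ 2 (value-mono (drop-∷-⊆ p⊆q)))
value-mono {p = outside ∷ p} {outside ∷ q} p⊆q = ℕ.*-monoʳ-≤ 2 (value-mono (drop-∷-⊆ p⊆q))

-- All digits below `x` together weigh less than the digit at `x`, so they may be arbitrary.
value-< : ∀ {p q : Subset n} x → x ∉ p → x ∈ q → (∀ {y} → x <ᶠ y → y ∈ p → y ∈ q) →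
          value p < value q
value-< {p = inside  ∷ p} zero x∉p here above = contradiction here x∉p
value-< {p = outside ∷ p} {inside ∷ q} zero x∉p here above =
  s≤s (ℕ.*-monoʳ-≤ 2 (value-mono λ y∈p → drop-there (above (s≤s z≤n) (there y∈p))))
value-< {p = a ∷ p} {b ∷ q} (suc x) x∉p (there x∈q) above = digit a b
  (value-< x (x∉p ∘ there) x∈q λ x<y y∈p → drop-there (above (s≤s x<y) (there y∈p)))
  where
  digit : ∀ a b → value p < value q → value (a ∷ p) < value (b ∷ q)
  digit inside b p<q = begin
    2 + 2 * value p   ≡⟨ ℕ.*-suc 2 (value p) ⟨
    2 * suc (value p) ≤⟨ ℕ.*-monoʳ-≤ 2 p<q ⟩
    2 * value q       ≤⟨ value-outside b ⟩
    value (b ∷ q)     ∎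
    where
    open ℕ.≤-Reasoning
    value-outside : ∀ b → 2 * value q ≤ value (b ∷ q)
    value-outside inside  = ℕ.n≤1+n _
    value-outside outside = ℕ.≤-refl
  digit outside inside  p<q = ℕ.m<n⇒m<1+n (ℕ.*-monoʳ-< 2 p<q)
  digit outside outside p<q = ℕ.*-monoʳ-< 2 p<q

least : ∀ {p : Subset n} → Nonempty p → ∃ λ x → x ∈ p × (∀ {y} → y ∈ p → x ≤ᶠ y)
least {p = inside  ∷ p} _                  = zero , here , λ _ → z≤n
least {p = outside ∷ p} (suc x , there x∈p) with least (x , x∈p)
... | y , y∈p , min = suc y , there y∈p , λ where (there z∈p) → s≤s (min z∈p)

-- Preservation in terms of rows, and the relations of the structure.

Respects≗ : ∀ {r} → Pred (Fin r → A) 0ℓ → Set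
Respects≗ R = ∀ {f g} → (∀ i → f i ≡ g i) → R f → R g

-- Rows are indexed by coordinates, so that an argument can follow one row at a time. `Respects≗`
-- replaces function extensionality in the passage to and from `Compatible`.
Preserves : ∀ {r} → Operation A k → Pred (Fin r → A) 0ℓ → Set
Preserves {A} {k} {r} t R = (rows : Fin r → Vec A k) → (∀ c → R (λ i → lookup (rows i) c)) → R (t ∘ rows)

module _ {r} {t : Operation A k} {R : Pred (Fin r → A) 0ℓ} (resp : Respects≗ R) where

  preserves⇒compatible : Preserves t R → Compatible t (R ∘ lookup)
  preserves⇒compatible pres columns all = resp (λ i → sym (lookup-map i t (transpose columns)))
    (pres (lookup (transpose columns)) λ c → resp (entry c) (All.lookup⁺ all c))
    where
    entry : ∀ c i → lookup (lookup columns c) i ≡ lookup (lookup (transpose columns) i) c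
    entry c i = sym (trans (cong (λ row → lookup row c) (lookup-transpose columns i)) (lookup-map c _ columns))

  compatible⇒preserves : Compatible t (R ∘ lookup) → Preserves t R
  compatible⇒preserves comp rows all = resp
    (λ i → trans (lookup-map i t (transpose columns)) (cong t (row i)))
    (comp columns (All.lookup⁻ λ c → resp (λ i → sym (column c i)) (all c)))
    where
    columns : Vec (Vec A r) k
    columns = tabulate λ c → tabulate λ i → lookup (rows i) c
    column : ∀ c i → lookup (lookup columns c) i ≡ lookup (rows i) c
    column c i = trans (cong (λ xs → lookup xs i) (lookup∘tabulate _ c)) (lookup∘tabulate _ i)
    row : ∀ i → lookup (transpose columns) i ≡ rows i
    row i = begin
      lookup (transpose columns) i                    ≡⟨ lookup-transpose columns i ⟩
      map (λ xs → lookup xs i) columns                ≡⟨ tabulate∘lookup _ ⟨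
      tabulate (lookup (map (λ xs → lookup xs i) columns))
        ≡⟨ tabulate-cong (λ c → trans (lookup-map c _ columns) (column c i)) ⟩
      tabulate (lookup (rows i))                      ≡⟨ tabulate∘lookup (rows i) ⟩
      rows i                                          ∎
      where open ≡-Reasoning

-- Coordinate `zero` is the parent, the others are its children. The first alternative copies
-- elements above `j`, just as a binary decrement at `j` keeps the higher digits. In the second, a
-- child strictly below `j` frees the parent to be anything up to `j`. One relation excludes only
-- the single value `e`, hence a relation for each star.
Descent : ∀ {l} (e j : Fin n) → Pred (Fin (suc l) → Fin n) 0ℓ
Descent e j x = (∃ λ h → j <ᶠ h × ∀ i → x i ≡ h)
              ⊎ ((∀ i → x i ≤ᶠ j) × ((∀ i → x (suc i) ≡ j) → x zero <ᶠ j × x zero ≢ e))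

descent-resp : ∀ {l} {e j : Fin n} → Respects≗ (Descent {l = l} e j)
descent-resp f≗g (inj₁ (h , j<h , f≡h)) = inj₁ (h , j<h , λ i → trans (sym (f≗g i)) (f≡h i))
descent-resp {j = j} f≗g (inj₂ (f≤j , down)) = inj₂
  ( (λ i → subst (_≤ᶠ j) (f≗g i) (f≤j i))
  , λ g≡j → subst (λ y → y <ᶠ j × y ≢ _) (f≗g zero) (down λ i → trans (f≗g (suc i)) (g≡j i)))

-- A near-unanimity polymorphism from weighted thresholds.

module ThresholdOperation {m : ℕ} (2≤m : 2 ≤ m) {n : ℕ} where

  weight : Subset n → ℕ
  weight p = m ^ (2 ^ n ∸ value p)

  deviations : Vec (Fin n) k → Subset n → Subset k
  deviations v p = subset (λ c → ¬? (lookup v c ∈? p))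

  record Tight (v : Vec (Fin n) k) (p : Subset n) : Set where
    constructor tight
    field few-deviations : ∣ deviations v p ∣ ≤ weight p
  open Tight

  instance
    m-nonZero : ℕ.NonZero m
    m-nonZero = ℕ.>-nonZero (ℕ.≤-trans (s≤s z≤n) 2≤m)

  -- The number of `q` is smaller than that of each `ps i`, so its weight is at least `m` times
  -- theirs and absorbs `r ≤ m` sets of deviations.
  tight-cover : r ≤ m → (vs : Fin r → Vec (Fin n) k) (ps : Fin r → Subset n) →
                (∀ i → Tight (vs i) (ps i)) → ∀ v q → (∀ i → value q < value (ps i)) →
                (∀ c → lookup v c ∉ q → ∃ λ i → lookup (vs i) c ∉ ps i) → Tight v q
  tight-cover {r} r≤m vs ps tights v q q<ps cover = tight (begin
    ∣ deviations v q ∣                  ≤⟨ union-bound (deviations v q) (λ i → deviations (vs i) (ps i)) cover′ small ⟩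
    r * m ^ (2 ^ n ∸ suc (value q))     ≤⟨ ℕ.*-monoˡ-≤ (m ^ (2 ^ n ∸ suc (value q))) r≤m ⟩
    -- `value q < 2 ^ n` keeps the truncated subtraction exact.
    m ^ suc (2 ^ n ∸ suc (value q))     ≡⟨ cong (m ^_) (ℕ.+-∸-assoc 1 (value<2^n q)) ⟨
    weight q                            ∎)
    where
    open ℕ.≤-Reasoning
    cover′ : ∀ {c} → c ∈ deviations v q → ∃ λ i → c ∈ deviations (vs i) (ps i)
    cover′ {c} c∈ with cover c (∈-subset⁻ (λ c → ¬? (lookup v c ∈? q)) c∈)
    ... | i , ∉p = i , ∈-subset⁺ (λ c → ¬? (lookup (vs i) c ∈? ps i)) ∉p
    small : ∀ i → ∣ deviations (vs i) (ps i) ∣ ≤ m ^ (2 ^ n ∸ suc (value q))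
    small i = ℕ.≤-trans (few-deviations (tights i)) (ℕ.^-monoʳ-≤ m (ℕ.∸-monoʳ-≤ (2 ^ n) (q<ps i)))

  tight-resp : ∀ {v v′ : Vec (Fin n) k} {p} → (∀ c → lookup v′ c ∉ p → lookup v c ∉ p) →
               Tight v p → Tight v′ p
  tight-resp {v = v} {v′} {p} ∉⇒∉ (tight few) = tight (ℕ.≤-trans (p⊆q⇒∣p∣≤∣q∣ λ {c} c∈ →
    ∈-subset⁺ (λ c → ¬? (lookup v c ∈? p)) (∉⇒∉ c (∈-subset⁻ (λ c → ¬? (lookup v′ c ∈? p)) c∈))) few)

  tight-except-one : ∀ (v : Vec (Fin n) k) p i → (∀ c → c ≢ i → lookup v c ∈ p) → Tight v p
  tight-except-one v p i rest = tight (begin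
    ∣ deviations v p ∣   ≤⟨ p⊆q⇒∣p∣≤∣q∣ dev⊆ ⟩
    ∣ ⁅ i ⁆ ∣            ≡⟨ ∣⁅x⁆∣≡1 i ⟩
    1                    ≤⟨ ℕ.m^n>0 m (2 ^ n ∸ value p) ⟩
    weight p             ∎)
    where
    open ℕ.≤-Reasoning
    dev⊆ : deviations v p ⊆ ⁅ i ⁆
    dev⊆ {c} c∈ with c ≟ i
    ... | yes refl = x∈⁅x⁆ i
    ... | no  c≢i  = contradiction (rest c c≢i) (∈-subset⁻ (λ c → ¬? (lookup v c ∈? p)) c∈)

  tight-⊤ : (v : Vec (Fin n) k) → Tight v ⊤
  tight-⊤ {k} v = tight (ℕ.≤-trans
    (p⊆q⇒∣p∣≤∣q∣ {q = ⊥} λ c∈ → contradiction ∈⊤ (∈-subset⁻ (λ c → ¬? (lookup v c ∈? ⊤)) c∈))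
    (ℕ.≤-trans (ℕ.≤-reflexive (∣⊥∣≡0 k)) z≤n))

  tight-⊥ : (v : Vec (Fin n) k) → Tight v ⊥ → k ≤ weight ⊥
  tight-⊥ {k} v (tight few) = ℕ.≤-trans (ℕ.≤-trans (ℕ.≤-reflexive (sym (∣⊤∣≡n k)))
    (p⊆q⇒∣p∣≤∣q∣ {p = ⊤} λ _ → ∈-subset⁺ (λ c → ¬? (lookup v c ∈? ⊥)) ∉⊥)) few

  Minimum : Vec (Fin n) k → Subset n → Set
  Minimum v p = Tight v p × (∀ {q} → Tight v q → p ⊆ q)

  private
    tight? : ∀ (v : Vec (Fin n) k) p → Dec (Tight v p)
    tight? v p = map′ tight few-deviations (∣ deviations v p ∣ ℕ.≤? weight p)

    minimize : ∀ (v : Vec (Fin n) k) p → Tight v p → Acc _<_ (value p) →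
               ∃ λ q → Tight v q × (∀ {r} → Tight v r → value q ≤ value r)
    minimize v p tight-p (acc rec) with anySubset? (λ q → tight? v q ×-dec (value q ℕ.<? value p))
    ... | yes (q , tight-q , q<p) = minimize v q tight-q (rec q<p)
    ... | no  none = p , tight-p , λ {r} tight-r → ℕ.≮⇒≥ λ r<p → none (r , tight-r , r<p)

  -- A tight set with the least number is also least for inclusion: if it were not inside a tight
  -- `q`, then `p ∩ q` would have a smaller number than both, hence be tight by `tight-cover`,
  -- against the choice of `p`.
  minimum-tight : (v : Vec (Fin n) k) → ∃ (Minimum v)
  minimum-tight v with minimize v ⊤ (tight-⊤ v) (<-wellFounded _)
  ... | p , tight-p , min = p , tight-p , λ {q} → p⊆ {q}
    where
    p⊆ : ∀ {q} → Tight v q → p ⊆ q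
    p⊆ {q} tight-q {x} x∈p = decidable-stable (x ∈? q) λ x∉q →
      let
        p∩q<p = value-< x (x∉q ∘ proj₂ ∘ x∈p∩q⁻ p q) x∈p (λ _ → proj₁ ∘ x∈p∩q⁻ p q)
        bound = λ where
          zero       → p∩q<p
          (suc zero) → ℕ.<-≤-trans p∩q<p (min {q} tight-q)
      in ℕ.<⇒≱ p∩q<p (min {p ∩ q} (tight-cover 2≤m (λ _ → v) sides tight-sides v (p ∩ q) bound cover))
      where
      sides : Fin 2 → Subset n
      sides zero       = p
      sides (suc zero) = q
      tight-sides : ∀ i → Tight v (sides i)
      tight-sides zero       = tight-p
      tight-sides (suc zero) = tight-q
      cover : ∀ c → lookup v c ∉ p ∩ q → ∃ λ i → lookup v c ∉ sides i
      cover c ∉p∩q with lookup v c ∈? p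
      ... | no  ∉p = zero , ∉p
      ... | yes ∈p = suc zero , λ ∈q → ∉p∩q (x∈p∩q⁺ (∈p , ∈q))

  IsThreshold : Vec (Fin n) k → Fin n → Set
  IsThreshold v x = ∃ λ p → Minimum v p × x ∈ p × (∀ {y} → y ∈ p → x ≤ᶠ y)

  module _ {k} (weight⊥<k : weight ⊥ < k) where

    -- All `k` entries deviate from `⊥`, more than `weight ⊥` tolerates.
    minimum-nonempty : ∀ {v : Vec (Fin n) k} {p} → Minimum v p → Nonempty p
    minimum-nonempty {v} {p} (tight-p , _) = decidable-stable (nonempty? p) λ empty →
      ℕ.<⇒≱ weight⊥<k (tight-⊥ v (subst (Tight v) (Empty-unique empty) tight-p))

    abstract
      threshold-spec : (v : Vec (Fin n) k) → ∃ (IsThreshold v)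
      threshold-spec v =
        let p , min       = minimum-tight v
            x , x∈p , x≤ = least (minimum-nonempty min)
        in x , p , min , x∈p , x≤

    threshold : Operation (Fin n) k
    threshold v = proj₁ (threshold-spec v)

    -- Every weight is at least one, so a single deviation leaves `⁅ a ⁆` tight, and the minimum
    -- tight set lies inside it.
    threshold-nearUnanimous : ∀ i a b → threshold (replicate k a [ i ]≔ b) ≡ a
    threshold-nearUnanimous i a b =
      let p , (_ , p⊆) , x∈p , _ = proj₂ (threshold-spec v)
      in x∈⁅y⁆⇒x≡y a (p⊆ (tight-except-one v ⁅ a ⁆ i a-elsewhere) x∈p)
      where
      v : Vec (Fin n) k
      v = replicate k a [ i ]≔ b
      a-elsewhere : ∀ c → c ≢ i → lookup v c ∈ ⁅ a ⁆
      a-elsewhere c c≢i = subst (_∈ ⁅ a ⁆)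
        (sym (trans (lookup∘update′ c≢i (replicate k a) b) (lookup-replicate c a))) (x∈⁅x⁆ a)

    threshold-preserves : ∀ {l} → l ≤ m → ∀ e j → Preserves threshold (Descent {l = l} e j)
    threshold-preserves {l} l≤m e j rows column = by-cases (any? (λ i → j <? t i))
      where
      t : Fin (suc l) → Fin n
      t i = threshold (rows i)

      p : Fin (suc l) → Subset n
      p i = proj₁ (proj₂ (threshold-spec (rows i)))

      p-minimum : ∀ i → Minimum (rows i) (p i)
      p-minimum i = proj₁ (proj₂ (proj₂ (threshold-spec (rows i))))

      t∈p : ∀ i → t i ∈ p i
      t∈p i = proj₁ (proj₂ (proj₂ (proj₂ (threshold-spec (rows i)))))

      t≤p : ∀ i {y} → y ∈ p i → t i ≤ᶠ y
      t≤p i = proj₂ (proj₂ (proj₂ (proj₂ (threshold-spec (rows i)))))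

      -- All rows deviate from a set lying above j in the same columns.
      above : ∀ {i} i′ → j <ᶠ t i → t i ≤ᶠ t i′
      above {i} i′ j<t = t≤p i (proj₂ (p-minimum i′) (tight-resp same (proj₁ (p-minimum i))) (t∈p i′))
        where
        same : ∀ c → lookup (rows i′) c ∉ p i → lookup (rows i) c ∉ p i
        same c ∉p with column c
        ... | inj₁ (h , _ , ≡h) = subst (_∉ p i) (trans (≡h i′) (sym (≡h i))) ∉p
        ... | inj₂ (≤j , _)     = λ ∈p → ℕ.<⇒≱ j<t (ℕ.≤-trans (t≤p i ∈p) (≤j i))

      -- The set `Q` allows, up to `j`, only the values wanted for the parent; above `j` it is the
      -- intersection of the children's sets. Lacking `j`, it has a smaller number than each of
      -- these, so the deviations of the children pay for those of the parent and `Q` is tight for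
      -- row `zero`.
      down : (∀ i → t i ≤ᶠ j) → (∀ i → t (suc i) ≡ j) → t zero <ᶠ j × t zero ≢ e
      down t≤j t≡j with ∈-subset⁻ Q? (proj₂ (p-minimum zero) tight-q (t∈p zero))
        where
        Q : Pred (Fin n) 0ℓ
        Q x = (x <ᶠ j × x ≢ e) ⊎ (j <ᶠ x × ∀ i → x ∈ p (suc i))
        Q? : Decidable Q
        Q? x = (x <? j ×-dec ¬? (x ≟ e)) ⊎-dec (j <? x ×-dec all? λ i → x ∈? p (suc i))
        q<p : ∀ i → value (subset Q?) < value (p (suc i))
        q<p i = value-< j j∉q (subst (_∈ p (suc i)) (t≡j i) (t∈p (suc i))) above-j
          where
          j∉q : j ∉ subset Q?
          j∉q j∈q with ∈-subset⁻ Q? j∈q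
          ... | inj₁ (j<j , _) = ℕ.<-irrefl refl j<j
          ... | inj₂ (j<j , _) = ℕ.<-irrefl refl j<j
          above-j : ∀ {y} → j <ᶠ y → y ∈ subset Q? → y ∈ p (suc i)
          above-j j<y y∈q with ∈-subset⁻ Q? y∈q
          ... | inj₁ (y<j , _)  = contradiction j<y (ℕ.<-asym y<j)
          ... | inj₂ (_ , y∈p) = y∈p i
        cover : ∀ c → lookup (rows zero) c ∉ subset Q? → ∃ λ i → lookup (rows (suc i)) c ∉ p (suc i)
        cover c ∉q = ¬∀⟶∃¬ l _ (λ i → lookup (rows (suc i)) c ∈? p (suc i)) λ ∈p → ∉q (∈-subset⁺ Q? (inQ ∈p (column c)))
          where
          inQ : (∀ i → lookup (rows (suc i)) c ∈ p (suc i)) →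
                Descent e j (λ i → lookup (rows i) c) → Q (lookup (rows zero) c)
          inQ ∈p (inj₁ (h , j<h , ≡h)) = inj₂
            ( subst (j <ᶠ_) (sym (≡h zero)) j<h
            , λ i → subst (_∈ p (suc i)) (trans (≡h (suc i)) (sym (≡h zero))) (∈p i))
          -- Each child entry is at most `j` and lies in a set with least element `j`, so it equals
          -- `j`.
          inQ ∈p (inj₂ (≤j , step)) = inj₁ (step λ i →
            Fin.≤-antisym (≤j (suc i)) (subst (_≤ᶠ _) (t≡j i) (t≤p (suc i) (∈p i))))
        tight-q : Tight (rows zero) (subset Q?)
        tight-q = tight-cover l≤m (rows ∘ suc) (p ∘ suc) (proj₁ ∘ p-minimum ∘ suc)
                    (rows zero) (subset Q?) q<p cover
      ... | inj₁ t∈Q       = t∈Q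
      ... | inj₂ (j<t , _) = contradiction j<t (ℕ.≤⇒≯ (t≤j zero))

      by-cases : Dec (∃ λ i → j <ᶠ t i) → Descent e j t
      -- One value above `j` puts all values above `j`, after which `above` applies in both
      -- directions.
      by-cases (yes (i , j<t)) = inj₁ (t i , j<t , λ i′ →
        Fin.≤-antisym (above i (ℕ.<-≤-trans j<t (above i′ j<t))) (above i′ j<t))
      by-cases (no none) = inj₂ (t≤j , down t≤j)
        where
        t≤j : ∀ i → t i ≤ᶠ j
        t≤j i = ℕ.≮⇒≥ λ j<t → none (i , j<t)

-- Subtracting one from a binary number.

record Predecessor (p q : Subset n) (j : Fin n) : Set where
  field
    j∈p   : j ∈ p
    j∉q   : j ∉ q
    j-min : ∀ {y} → y ∈ p → j ≤ᶠ y
    below : ∀ {y} → y <ᶠ j → y ∈ q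
    p⇒q   : ∀ {y} → j <ᶠ y → y ∈ p → y ∈ q
    q⇒p   : ∀ {y} → j <ᶠ y → y ∈ q → y ∈ p

-- This is borrowing: `j` is the lowest digit one of `p`; it is cleared, the zeros below it become
-- ones, and the higher digits stay.
predecessor : ∀ (p : Subset n) {v} → value p ≡ suc v →
              ∃ λ q → ∃ λ j → value q ≡ v × Predecessor p q j
predecessor (inside ∷ p) eq = outside ∷ p , zero , ℕ.suc-injective eq , record
  { j∈p   = here
  ; j∉q   = λ ()
  ; j-min = λ _ → z≤n
  ; below = λ ()
  ; p⇒q   = λ where _ (there y∈p) → there y∈p
  ; q⇒p   = λ where _ (there y∈q) → there y∈q
  }
predecessor (outside ∷ p) {v} eq with value p in eq-p
... | suc w with predecessor p eq-p
...   | q , j , eq-q , pred = inside ∷ q , suc j , value-q , record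
  { j∈p   = there j∈p
  ; j∉q   = j∉q ∘ drop-there
  ; j-min = λ where (there y∈p) → s≤s (j-min y∈p)
  ; below = below′
  ; p⇒q   = λ where (s≤s j<y) (there y∈p) → there (p⇒q j<y y∈p)
  ; q⇒p   = λ where (s≤s j<y) (there y∈q) → there (q⇒p j<y y∈q)
  }
  where
  open Predecessor pred
  below′ : ∀ {y} → y <ᶠ suc j → y ∈ inside ∷ q
  below′ {zero}  _         = here
  below′ {suc y} (s≤s y<j) = there (below y<j)
  value-q : value (inside ∷ q) ≡ v
  value-q = ℕ.suc-injective (begin
    2 + 2 * value q   ≡⟨ cong (λ z → 2 + 2 * z) eq-q ⟩
    2 + 2 * w         ≡⟨ ℕ.*-suc 2 w ⟨
    2 * suc w         ≡⟨ eq ⟩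
    suc v             ∎)
    where open ≡-Reasoning

value-⁅max⁆ : ∀ d → value ⁅ fromℕ d ⁆ ≡ 2 ^ d
value-⁅max⁆ zero    = refl
value-⁅max⁆ (suc d) = cong (2 *_) (value-⁅max⁆ d)

value≡0⇒∉ : ∀ {p : Subset n} {x} → value p ≡ 0 → x ∉ p
value≡0⇒∉ {p = outside ∷ p} eq (there x∈p) = value≡0⇒∉ (ℕ.m+n≡0⇒m≡0 (value p) eq) x∈p

-- The lower bound on the arity.

module LowerBound (s′ l′ d : ℕ) where

  s l : ℕ
  s = suc s′
  l = suc l′

  Element Bit Branch : Set
  Element = Fin (s + suc d)
  Bit = Fin (suc d)
  Branch = Fin s × Fin l

  -- A path of branches. Its head names the star, and the child of that star, through which an
  -- argument stays free in the current step; the tail serves the steps after it in the recursion.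
  Leaf : ℕ → Set
  Leaf = Vec Branch

  star : Fin s → Element
  star e = e ↑ˡ suc d

  bit : Bit → Element
  bit y = s ↑ʳ y

  bit-mono-< : ∀ {y z} → y <ᶠ z → bit y <ᶠ bit z
  bit-mono-< {y} {z} y<z = subst₂ _<_ (sym (toℕ-↑ʳ s y)) (sym (toℕ-↑ʳ s z)) (ℕ.+-monoʳ-< s y<z)

  bit-cancel-< : ∀ {y z} → bit y <ᶠ bit z → y <ᶠ z
  bit-cancel-< {y} {z} = ℕ.+-cancelˡ-< s _ _ ∘ subst₂ _<_ (toℕ-↑ʳ s y) (toℕ-↑ʳ s z)

  bit-cancel-≤ : ∀ {y z} → bit y ≤ᶠ bit z → y ≤ᶠ z
  bit-cancel-≤ {y} {z} = ℕ.+-cancelˡ-≤ s _ _ ∘ subst₂ _≤_ (toℕ-↑ʳ s y) (toℕ-↑ʳ s z)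

  star<bit : ∀ e y → star e <ᶠ bit y
  star<bit e y = subst₂ _<_ (sym (toℕ-↑ˡ e (suc d))) (sym (toℕ-↑ʳ s y))
    (ℕ.<-≤-trans (Fin.toℕ<n e) (ℕ.m≤m+n s (toℕ y)))

  star≢bit : ∀ {e y} → star e ≢ bit y
  star≢bit {e} {y} eq = ℕ.<-irrefl (cong toℕ eq) (star<bit e y)

  star-or-bit : ∀ x → (∃ λ e → x ≡ star e) ⊎ (∃ λ y → x ≡ bit y)
  star-or-bit x with splitAt s x | join-splitAt s (suc d) x
  ... | inj₁ e | eq = inj₁ (e , sym eq)
  ... | inj₂ y | eq = inj₂ (y , sym eq)

  Matches : ∀ {r} → Element → Bit ⊎ Leaf r → Set
  Matches x (inj₁ y) = x ≡ bit y
  Matches x (inj₂ _) = ∃ λ e → x ≡ star e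

  parent : Bit ⊎ Leaf (suc r) → Element
  parent (inj₁ y)             = bit y
  parent (inj₂ ((e , _) ∷ _)) = star e

  parent-matches : (w : Bit ⊎ Leaf (suc r)) → Matches (parent w) w
  parent-matches (inj₁ _)             = refl
  parent-matches (inj₂ ((e , _) ∷ _)) = e , refl

  _≟ᴮ_ : (β γ : Branch) → Dec (β ≡ γ)
  _≟ᴮ_ = ≡-dec _≟_ _≟_

  -- What the child at branch `β` must carry below a given parent entry. Bits above `j` are copied
  -- and other bits become `j`; a free entry stays free only in the branch heading its label and
  -- becomes `j` in all others.
  child : Bit → Branch → Bit ⊎ Leaf (suc r) → Bit ⊎ Leaf r
  child j β (inj₁ y) with j <? y
  ... | yes _ = inj₁ y
  ... | no  _ = inj₁ j
  child j β (inj₂ (γ ∷ ℓ)) with γ ≟ᴮ β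
  ... | yes _ = inj₂ ℓ
  ... | no  _ = inj₁ j

  child-inj₂ : ∀ j β (w : Bit ⊎ Leaf (suc r)) {ℓ} → child j β w ≡ inj₂ ℓ → w ≡ inj₂ (β ∷ ℓ)
  child-inj₂ j β (inj₁ y) eq with j <? y
  child-inj₂ j β (inj₁ y) () | yes _
  child-inj₂ j β (inj₁ y) () | no _
  child-inj₂ j β (inj₂ (γ ∷ ℓ)) eq with γ ≟ᴮ β
  child-inj₂ j β (inj₂ (γ ∷ ℓ)) refl | yes refl = refl

  module _ {p q : Subset (suc d)} {j : Bit} (pred : Predecessor p q j) where
    open Predecessor pred

    child-inj₁ : ∀ β (w : Bit ⊎ Leaf (suc r)) → (∀ {y} → w ≡ inj₁ y → y ∈ q) →
                 ∀ {y} → child j β w ≡ inj₁ y → y ∈ p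
    child-inj₁ β (inj₁ z) ∈q eq with j <? z
    child-inj₁ β (inj₁ z) ∈q refl | yes j<z = q⇒p j<z (∈q refl)
    child-inj₁ β (inj₁ z) ∈q refl | no  _   = j∈p
    child-inj₁ β (inj₂ (γ ∷ ℓ)) ∈q eq with γ ≟ᴮ β
    child-inj₁ β (inj₂ (γ ∷ ℓ)) ∈q refl | no _ = j∈p

    -- A bit above `j` gives a constant column, and a bit of `q` below `j` sits over children all
    -- equal to `j`. A parent `star e` is permitted because one of its children is free, hence a
    -- star rather than `j`; any other star satisfies the conclusion of the descent outright.
    family-descent : ∀ e (w : Bit ⊎ Leaf (suc r)) → (∀ {y} → w ≡ inj₁ y → y ∈ q) →
                     (x : Fin (suc l) → Element) → x zero ≡ parent w →
                     (∀ i → Matches (x (suc i)) (child j (e , i) w)) →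
                     Descent (star e) (bit j) x
    family-descent e (inj₁ y) ∈q x x₀ xs with j <? y
    ... | yes j<y = inj₁ (bit y , bit-mono-< j<y , λ where
      zero    → x₀
      (suc i) → xs i)
    ... | no  j≮y = inj₂ (x≤j , λ _ → subst (λ z → z <ᶠ bit j × z ≢ star e) (sym x₀) (bit-mono-< y<j , star≢bit ∘ sym))
      where
      y<j : y <ᶠ j
      y<j = Fin.≤∧≢⇒< (ℕ.≮⇒≥ j≮y) λ where refl → j∉q (∈q refl)
      x≤j : ∀ i → x i ≤ᶠ bit j
      x≤j zero    = ℕ.≤-trans (ℕ.≤-reflexive (cong toℕ x₀)) (ℕ.<⇒≤ (bit-mono-< y<j))
      x≤j (suc i) = ℕ.≤-reflexive (cong toℕ (xs i))
    family-descent e (inj₂ (γ@(e₀ , i₀) ∷ ℓ)) ∈q x x₀ xs = inj₂ (x≤j , λ x≡j → x₀<j , λ x₀≡e →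
      freed x≡j (Fin.↑ˡ-injective (suc d) e₀ e (trans (sym x₀) x₀≡e)) (xs i₀))
      where
      x₀<j : x zero <ᶠ bit j
      x₀<j = subst (_<ᶠ bit j) (sym x₀) (star<bit e₀ j)
      child≤j : ∀ {z} i → Matches z (child j (e , i) (inj₂ (γ ∷ ℓ))) → z ≤ᶠ bit j
      child≤j i m with γ ≟ᴮ (e , i)
      child≤j i (e′ , refl) | yes _ = ℕ.<⇒≤ (star<bit e′ j)
      child≤j i refl        | no  _ = ℕ.≤-refl
      x≤j : ∀ i → x i ≤ᶠ bit j
      x≤j zero    = ℕ.<⇒≤ x₀<j
      x≤j (suc i) = child≤j i (xs i)
      freed : (∀ i → x (suc i) ≡ bit j) → e₀ ≡ e → ¬ Matches (x (suc i₀)) (child j (e , i₀) (inj₂ (γ ∷ ℓ)))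
      freed x≡j refl m with γ ≟ᴮ γ
      freed x≡j refl (_ , x≡star) | yes _  = star≢bit (trans (sym x≡star) (x≡j i₀))
      freed x≡j refl _            | no γ≢γ = γ≢γ refl

  module _ {k} (t : Operation Element k) (t-nu : IsNearUnanimity t)
           (t-preserves : ∀ e j → Preserves t (Descent {l = l} (star e) j)) where

    -- u prescribes a bit of p in some arguments and leaves the others free to be any
    -- star; the latter carry distinct leaf labels, so there are at most (s * l) ^ r.
    Forces : ℕ → Subset (suc d) → Set
    Forces r p = (u : Fin k → Bit ⊎ Leaf r) →
      (∀ {c y} → u c ≡ inj₁ y → y ∈ p) →
      (∀ {c c′ ℓ} → u c ≡ inj₂ ℓ → u c′ ≡ inj₂ ℓ → c ≡ c′) →
      ∃ λ v → (∀ c → Matches (lookup v c) (u c)) × ∃ λ y → y ∈ p × t v ≡ bit y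

    -- There is just one label of length zero, so at most one argument is free and near-unanimity
    -- applies.
    forces-top : Forces 0 ⁅ fromℕ d ⁆
    forces-top u u∈p u-inj = by-cases (any? freed?)
      where
      top : Element
      top = bit (fromℕ d)
      Freed : Pred (Fin k) 0ℓ
      Freed c = u c ≡ inj₂ []
      freed? : Decidable Freed
      freed? c with u c
      ... | inj₁ _  = no λ ()
      ... | inj₂ [] = yes refl
      not-freed : ∀ c → ¬ Freed c → Matches top (u c)
      not-freed c ¬freed with u c in eq
      ... | inj₁ y  = sym (cong bit (x∈⁅y⁆⇒x≡y (fromℕ d) (u∈p eq)))
      ... | inj₂ [] = contradiction refl ¬freed
      result : ∀ i x → (∀ c → Matches (lookup (replicate k top [ i ]≔ x) c) (u c)) →
               ∃ λ v → (∀ c → Matches (lookup v c) (u c)) × ∃ λ y → y ∈ ⁅ fromℕ d ⁆ × t v ≡ bit y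
      result i x match = replicate k top [ i ]≔ x , match , fromℕ d , x∈⁅x⁆ (fromℕ d) , proj₂ t-nu i top x
      elsewhere : ∀ {i x} c → c ≢ i → ¬ Freed c → Matches (lookup (replicate k top [ i ]≔ x) c) (u c)
      elsewhere {x = x} c c≢i ¬freed = subst (λ z → Matches z (u c))
        (sym (trans (lookup∘update′ c≢i (replicate k top) x) (lookup-replicate c top))) (not-freed c ¬freed)
      by-cases : Dec (∃ Freed) → _
      by-cases (yes (i , freed)) = result i (star zero) match
        where
        match : ∀ c → Matches (lookup (replicate k top [ i ]≔ star zero) c) (u c)
        match c with c ≟ i
        ... | yes refl = subst₂ Matches (sym (lookup∘update i (replicate k top) (star zero))) (sym freed) (zero , refl)
        ... | no  c≢i  = elsewhere c c≢i λ freed′ → c≢i (u-inj freed′ freed)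
      -- With no free argument the "deviating" entry is `top` as well; a position for it exists
      -- because `3 ≤ k`.
      by-cases (no none) = result i₀ top match
        where
        i₀ : Fin k
        i₀ = fromℕ< (ℕ.≤-trans (s≤s z≤n) (proj₁ t-nu))
        match : ∀ c → Matches (lookup (replicate k top [ i₀ ]≔ top) c) (u c)
        match c with c ≟ i₀
        ... | yes refl = subst (λ z → Matches z (u c)) (sym (lookup∘update c (replicate k top) top)) (not-freed c λ f → none (c , f))
        ... | no  c≢i  = elsewhere c c≢i λ f → none (c , f)

    -- The hypothesis is applied once per branch, and the relation of each star to `v₀` and the
    -- vectors of its children. The children's values lie in `p`, whose least element is `j`: either
    -- they share a value above `j`, which is then in `q`, or all equal `j` and `t v₀` descends
    -- below `j`, avoiding that star. Avoiding every star, it is a bit below `j`, and `q` contains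
    -- all of these.
    forces-step : ∀ {p q j} → Predecessor p q j → Forces r p → Forces (suc r) q
    forces-step {r} {p} {q} {j} pred forces-p u u∈q u-inj = v₀ , match₀ , conclude (star-or-bit (t v₀))
      where
      open Predecessor pred

      below-child : ∀ β → _
      below-child β = forces-p (child j β ∘ u)
        (λ {c} → child-inj₁ pred β (u c) u∈q)
        -- Prepending `β` recovers the parent's label, so labels stay distinct.
        (λ {c} {c′} eq eq′ → u-inj (child-inj₂ j β (u c) eq) (child-inj₂ j β (u c′) eq′))

      v₀ : Vec Element k
      v₀ = tabulate (parent ∘ u)

      match₀ : ∀ c → Matches (lookup v₀ c) (u c)
      match₀ c = subst (λ x → Matches x (u c)) (sym (lookup∘tabulate (parent ∘ u) c)) (parent-matches (u c))

      rows : Fin s → Fin (suc l) → Vec Element k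
      rows e zero    = v₀
      rows e (suc i) = proj₁ (below-child (e , i))

      tight : ∀ e i → ∃ λ y → y ∈ p × t (rows e (suc i)) ≡ bit y
      tight e i = proj₂ (proj₂ (below-child (e , i)))

      family : ∀ e → (∃ λ y → y ∈ q × t v₀ ≡ bit y) ⊎ (t v₀ <ᶠ bit j × t v₀ ≢ star e)
      family e with t-preserves e (bit j) (rows e) (λ c → family-descent pred e (u c) u∈q _
                      (lookup∘tabulate (parent ∘ u) c) (λ i → proj₁ (proj₂ (below-child (e , i))) c))
      ... | inj₁ (h , j<h , ≡h) =
        let y , y∈p , eq = tight e zero
            h≡y = trans (sym (≡h (suc zero))) eq
        in inj₁ (y , p⇒q (bit-cancel-< (subst (bit j <ᶠ_) h≡y j<h)) y∈p , trans (≡h zero) h≡y)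
      ... | inj₂ (≤j , down) = inj₂ (down λ i →
        let y , y∈p , eq = tight e i
        in trans eq (cong bit (Fin.≤-antisym (bit-cancel-≤ (subst (_≤ᶠ bit j) eq (≤j (suc i)))) (j-min y∈p))))

      conclude : (∃ λ e → t v₀ ≡ star e) ⊎ (∃ λ y → t v₀ ≡ bit y) → ∃ λ y → y ∈ q × t v₀ ≡ bit y
      -- A value `star e` is refuted by the relation for this very star.
      conclude (inj₁ (e , t≡e)) with family e
      ... | inj₁ in-q      = in-q
      ... | inj₂ (_ , t≢e) = contradiction t≡e t≢e
      conclude (inj₂ (y , t≡y)) with family zero
      ... | inj₁ in-q      = in-q
      ... | inj₂ (t<j , _) = y , below (bit-cancel-< (subst (_<ᶠ bit j) t≡y t<j)) , t≡y

    countdown : ∀ r → r ≤ 2 ^ d → ∃ λ p → value p ≡ 2 ^ d ∸ r × Forces r p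
    countdown zero    _   = ⁅ fromℕ d ⁆ , value-⁅max⁆ d , forces-top
    countdown (suc r) r<D =
      let p , value-p , forces-p = countdown r (ℕ.<⇒≤ r<D)
          q , j , value-q , pred = predecessor p (trans value-p (ℕ.+-∸-assoc 1 r<D))
      in q , value-q , forces-step pred forces-p

    -- The digits of the index in base `s * l`, leading digit first, each split into a star and a
    -- child.
    leaf : ∀ r → Fin ((s * l) ^ r) → Leaf r
    leaf zero    _ = []
    leaf (suc r) i = let β , i′ = remQuot {s * l} ((s * l) ^ r) i in remQuot l β ∷ leaf r i′

    leaf-injective : ∀ r {i i′} → leaf r i ≡ leaf r i′ → i ≡ i′
    leaf-injective zero    {zero} {zero} _ = refl
    leaf-injective (suc r) {i} {i′} eq =
      remQuot-injective ((s * l) ^ r) (×-≡,≡→≡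
        (remQuot-injective l (∷-injectiveˡ eq) , leaf-injective r (∷-injectiveʳ eq)))
      where
      remQuot-injective : ∀ {a} c {i i′ : Fin (a * c)} → remQuot {a} c i ≡ remQuot c i′ → i ≡ i′
      remQuot-injective {a} c {i} {i′} eq =
        trans (sym (combine-remQuot {a} c i)) (trans (cong (uncurry combine) eq) (combine-remQuot {a} c i′))

    -- There are enough labels of length `2 ^ d` to make all `k` arguments free, so no bit is
    -- prescribed; yet after `2 ^ d` decrements the forced value would lie in the empty set.
    arity-bound : ¬ k ≤ (s * l) ^ (2 ^ d)
    arity-bound k≤ =
      let p , value-p , forces = countdown (2 ^ d) ℕ.≤-refl
          _ , _ , _ , y∈p , _ = forces (λ c → inj₂ (leaf (2 ^ d) (inject≤ c k≤))) (λ ())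
            λ eq eq′ → inject≤-injective k≤ k≤ _ _ (leaf-injective (2 ^ d) (inj₂-injective (trans eq (sym eq′))))
      in value≡0⇒∉ (trans value-p (ℕ.n∸n≡0 (2 ^ d))) y∈p

-- The structure and the two choices of parameters.

module _ (s′ l′ d : ℕ) where
  open LowerBound s′ l′ d using (s; l; Element; star; arity-bound)

  descent : Fin s × Element → Pred (Fin (suc l) → Element) 0ℓ
  descent (e , j) = Descent (star e) j

  descentStructure : RelationalStructure
  descentStructure = record
    { Universe   = Element
    ; #relations = s * (s + suc d)
    ; arity      = λ _ → suc l
    ; relation   = λ i → descent (remQuot (s + suc d) i) ∘ lookup
    }

  descentStructure-hasNU : ∃ (HasNUPolymorphism descentStructure)
  -- Exceeding `weight ⊥` keeps `⊥` from being tight; the summand `3` also secures the least arity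
  -- of a near-unanimity operation.
  descentStructure-hasNU = 3 + weight ⊥ , threshold large
                         , (s≤s (s≤s (s≤s z≤n)) , threshold-nearUnanimous large)
                         , λ i → let e , j = remQuot (s + suc d) i in
                             preserves⇒compatible {R = descent (e , j)} descent-resp
                               (threshold-preserves large (ℕ.n≤1+n l) (star e) j)
    where
    -- The base is `suc l` rather than `l`, to be at least two even for stars with one child.
    2≤m : 2 ≤ suc l
    2≤m = s≤s (s≤s z≤n)
    open ThresholdOperation 2≤m {s + suc d}
    large : weight ⊥ < 3 + weight ⊥
    large = s≤s (ℕ.m≤n+m (weight ⊥) 2)

  descentStructure-noSmallNU : k ≤ (s * l) ^ (2 ^ d) → ¬ HasNUPolymorphism descentStructure k
  descentStructure-noSmallNU k≤ (t , t-nu , t-pol) = arity-bound t t-nu preserves k≤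
    where
    preserves : ∀ e j → Preserves t (Descent {l = l} (star e) j)
    preserves e j = compatible⇒preserves {R = descent (e , j)} descent-resp
      (subst (λ i → Compatible t (descent i ∘ lookup))
        (remQuot-combine e j) (t-pol (combine e j)))

theorem2 : ∀ (m n : ℕ) → (3 ≤ m × 2 ≤ n) ⊎ (m ≡ 2 × 3 ≤ n) →
    ∃ λ (𝔸 : RelationalStructure) → let open RelationalStructure 𝔸 in
    (Fin n ↔ Universe)
    × (∀ i → arity i ≤ m)
    × (∃ λ k → HasNUPolymorphism 𝔸 k)
    × (3 ≤ m → ∀ k → k ≤ (m ∸ 1) ^ (2 ^ (n ∸ 2)) → ¬ HasNUPolymorphism 𝔸 k)
    × (m ≡ 2 → ∀ k → k ≤ 2 ^ (2 ^ (n ∸ 3)) → ¬ HasNUPolymorphism 𝔸 k)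
theorem2 (suc (suc (suc m))) (suc (suc d)) (inj₁ (s≤s (s≤s (s≤s z≤n)) , s≤s (s≤s z≤n))) =
    -- One star with `2 + m` children, one fewer than the arity, and `suc d` bits.
    descentStructure 0 (suc m) d
  , ↔-id _
  , (λ _ → ℕ.≤-refl)
  , descentStructure-hasNU 0 (suc m) d
  , (λ _ k k≤ → descentStructure-noSmallNU 0 (suc m) d
      (subst (λ b → k ≤ b ^ (2 ^ d)) (sym (ℕ.*-identityˡ (2 + m))) k≤))
  , λ ()
theorem2 2 (suc (suc (suc d))) (inj₂ (refl , s≤s (s≤s (s≤s z≤n)))) =
    -- Binary relations leave a star only one child, so a single star would give base one; a second
    -- star raises it to two at the cost of one bit.
    descentStructure 1 0 d
  , ↔-id _
  , (λ _ → ℕ.≤-refl)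
  , descentStructure-hasNU 1 0 d
  , (λ where (s≤s (s≤s ())))
  , λ _ _ → descentStructure-noSmallNU 1 0 d
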